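{- Let $n$ be a non-negative integer and let $a,b$ be integers with $\gcd(a,b)=1$, $a+b\neq 0$ and $a+b\neq \pm 1$. For natural numbers $N$ put $B(N,2,a,b)=\sum_{k=0}^{N}\binom{N}{k}^2 a^{N-k}b^k$. Then $$\omega_{a+b}\big(B(2n,2,a,b)\big)=\omega_{a+b}\Big(\binom{2n}{n}\Big),\qquad \omega_{a+b}\big(B(2n+1,2,a,b)\big)=1+\omega_{a+b}\Big((2n+1)\binom{2n}{n}\Big).$$
   Context: For an integer $x$ with $x\neq 0$ and $x\neq\pm1$ and a nonzero integer $y$, $\omega_x(y)$ denotes the largest non-negative integer $e$ such that $x^e$ divides $y$ (when $x$ is a prime $p$ this is the $p$-adic valuation $v_p(y)$). -}

module Defs where

open import Data.Fin using (toℕ)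
open import Data.Integer using (ℤ; +_; -[1+_]; ∣_∣; 0ℤ; 1ℤ; -1ℤ; _*_; _^_)
open import Data.Integer.Divisibility.Signed using (_∣_; _∣?_; divides; ∣⇒∣ᵤ)
import Data.Integer.Properties as ℤ
open import Algebra.Properties.Semiring.Sum ℤ.+-*-semiring using (sum⁺-syntax)
open import Data.Nat using (ℕ; zero; suc; _∸_; _≤_; _<_; z≤n; s≤s)
open import Data.Nat.Combinatorics using (_C_)
import Data.Nat as ℕ
import Data.Nat.Divisibility as ℕ
import Data.Nat.Properties as ℕ
open import Relation.Binary.PropositionalEquality
open import Relation.Nullary using (yes; no; contradiction)
open import Relation.Unary using (Pred; Decidable)
open import Level using (0ℓ)

B : (N r : ℕ) (a b : ℤ) → ℤ
B N r a b = ∑[ k ≤ N ] ((+ (N C toℕ k)) ^ r * a ^ (N ∸ toℕ k) * b ^ toℕ k)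

greatest≤ : {P : Pred ℕ 0ℓ} → Decidable P → ℕ → ℕ
greatest≤ P? zero    = zero
greatest≤ P? (suc m) with P? (suc m)
... | yes _ = suc m
... | no  _ = greatest≤ P? m

-- The largest e with x ^ e ∣ y, for y ≢ 0 and x ∉ {0, 1, -1}: in that range
-- x ^ e ∣ y forces e ≤ ∣ y ∣, so searching up to ∣ y ∣ loses nothing
-- (see ω-∣ and ω-largest).  Outside that range the value is meaningless.
ω : ℤ → ℤ → ℕ
ω x y = greatest≤ (λ e → x ^ e ∣? y) ∣ y ∣

greatest≤-holds : {P : Pred ℕ 0ℓ} (P? : Decidable P) → P 0 →
                  ∀ m → P (greatest≤ P? m)
greatest≤-holds P? p₀ zero = p₀
greatest≤-holds P? p₀ (suc m) with P? (suc m)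
... | yes p = p
... | no  _ = greatest≤-holds P? p₀ m

greatest≤-largest : {P : Pred ℕ 0ℓ} (P? : Decidable P) →
                    ∀ m e → e ≤ m → P e → e ≤ greatest≤ P? m
greatest≤-largest P? zero    e e≤0 p = e≤0
greatest≤-largest P? (suc m) e e≤m p with P? (suc m)
... | yes _ = e≤m
... | no ¬p with e ℕ.≟ suc m
...   | yes refl = contradiction p ¬p
...   | no  e≢m  = greatest≤-largest P? m e (ℕ.≤-pred (ℕ.≤∧≢⇒< e≤m e≢m)) p

abs-^ : ∀ x e → ∣ x ^ e ∣ ≡ ∣ x ∣ ℕ.^ e
abs-^ x zero    = refl
abs-^ x (suc e) = trans (ℤ.abs-* x (x ^ e)) (cong (∣ x ∣ ℕ.*_) (abs-^ x e))

1<∣_∣ : ∀ x → x ≢ 0ℤ → x ≢ 1ℤ → x ≢ -1ℤ → 1 < ∣ x ∣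
1<∣ + 0 ∣           x≢0 _ _ = contradiction refl x≢0
1<∣ + 1 ∣           _ x≢1 _ = contradiction refl x≢1
1<∣ + suc (suc _) ∣ _ _ _   = s≤s (s≤s z≤n)
1<∣ -[1+ 0 ] ∣      _ _ x≢-1 = contradiction refl x≢-1
1<∣ -[1+ suc _ ] ∣  _ _ _   = s≤s (s≤s z≤n)

e≤m^e : ∀ m → 1 < m → ∀ e → e ≤ m ℕ.^ e
e≤m^e m 1<m zero    = z≤n
e≤m^e m 1<m (suc e) =
  ℕ.≤-<-trans (e≤m^e m 1<m e) (ℕ.^-monoʳ-< m 1<m (ℕ.n<1+n e))

ω-∣ : ∀ x y → x ^ ω x y ∣ y
ω-∣ x y = greatest≤-holds (λ e → x ^ e ∣? y) (divides y (sym (ℤ.*-identityʳ y))) ∣ y ∣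

ω-largest : ∀ x y → x ≢ 0ℤ → x ≢ 1ℤ → x ≢ -1ℤ → y ≢ 0ℤ →
            ∀ e → x ^ e ∣ y → e ≤ ω x y
ω-largest x y x≢0 x≢1 x≢-1 y≢0 e x^e∣y =
  greatest≤-largest (λ e → x ^ e ∣? y) ∣ y ∣ e e≤∣y∣ x^e∣y
  where
  instance _ = ℕ.≢-nonZero (λ ∣y∣≡0 → y≢0 (ℤ.∣i∣≡0⇒i≡0 ∣y∣≡0))
  e≤∣y∣ : e ≤ ∣ y ∣
  e≤∣y∣ = begin
    e              ≤⟨ e≤m^e ∣ x ∣ (1<∣ x ∣ x≢0 x≢1 x≢-1) e ⟩
    ∣ x ∣ ℕ.^ e    ≡⟨ abs-^ x e ⟨
    ∣ x ^ e ∣      ≤⟨ ℕ.∣⇒≤ (∣⇒∣ᵤ x^e∣y) ⟩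
    ∣ y ∣          ∎
    where open ℕ.≤-Reasoning

{-# OPTIONS --safe #-}

-- Write s = a + b, p = a b and N = 2 n + d with d ≤ 1.  Comparing the coefficients of X ^ N in
-- (X + a) ^ N (X + b) ^ N = (X (X + s) + p) ^ N gives
--   B N 2 a b = Σ_i C(N, n + d + i) C(n + d + i, n - i) p ^ (n - i) s ^ (2 i + d),
-- and for M n = (2 n + d)! / (n !) ^ 2 the i-th term is
--   s ^ d (M n) p ^ (n - i) C(n, i) ^ 2 s ^ (2 i) / M i.
-- If i ≥ 1, each prime divides M i fewer than 2 i times, so up to a factor coprime to s these terms
-- are multiples of s ^ d (M n) s.  The term i = 0 is s ^ d (M n) p ^ n, with p coprime to s.
module Submission where

open import Data.Fin as Fin using (Fin; toℕ; fromℕ<; punchIn)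
import Data.Fin.Properties as Fin
open import Data.Integer as ℤ using (ℤ; +_; 0ℤ; 1ℤ; -1ℤ; ∣_∣)
  renaming (_+_ to _+ℤ_; _*_ to _*ℤ_; _^_ to _^ℤ_)
open import Data.Integer.Coprimality as ℤ using () renaming (Coprime to Coprimeℤ)
open import Data.Integer.Divisibility.Signed as ℤ using (∣⇒∣ᵤ; ∣ᵤ⇒∣) renaming (_∣_ to _∣ℤ_)
open import Data.Integer.GCD as ℤ using (gcd)
import Data.Integer.Properties as ℤ
import Data.Integer.Tactic.RingSolver as ℤ
open import Data.Nat
  using (ℕ; zero; suc; _+_; _*_; _^_; _∸_; _≤_; _<_; z≤n; s≤s; NonZero; _!;
         >-nonZero; ≢-nonZero; ≢-nonZero⁻¹)
open import Data.Nat.Combinatorics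
  using (_C_; nCk+nC[k+1]≡[n+1]C[k+1]; k>n⇒nCk≡0; nCk≡nC[n∸k]; nCk≡n!/k![n-k]!; k![n∸k]!∣n!)
open import Data.Nat.Coprimality as Coprimality using (Coprime; gcd≡1⇒coprime; coprime-divisor)
open import Data.Nat.Divisibility
open import Data.Nat.DivMod using (m/n*n≡m)
import Data.Nat.GCD as ℕ
open import Data.Nat.Properties
open import Data.Nat.Tactic.RingSolver using (solve-∀)
open import Data.Product using (_×_; _,_; ∃; ∃₂; proj₁; proj₂)
open import Data.Sum using (inj₁; inj₂)
open import Data.Vec.Functional using (removeAt)
open import Defs using (B; ω; ω-∣; ω-largest; 1<∣_∣; abs-^)
open import Function using (_∘_)
open import Relation.Binary.Definitions using (tri<; tri≈; tri>)
open import Relation.Binary.PropositionalEquality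
open import Relation.Nullary using (yes; no; contradiction; ¬_)
open import Algebra.Properties.Semiring.Sum ℤ.+-*-semiring

-- Finite sums and the binomial theorem in the form of a recurrence.

sum-last : ∀ n (f : ℕ → ℤ) → ∑[ k ≤ n ] f (toℕ k) ≡ ∑[ k < n ] f (toℕ k) +ℤ f n
sum-last zero    f = ℤ.+-comm (f 0) 0ℤ
sum-last (suc n) f = trans (cong (λ x → f 0 +ℤ x) (sum-last n (f ∘ suc)))
                           (sym (ℤ.+-assoc (f 0) (∑[ k < n ] f (suc (toℕ k))) (f (suc n))))

pascal : ∀ n k → + (suc n C suc k) ≡ + (n C k) +ℤ + (n C suc k)
pascal n k = trans (cong +_ (sym (nCk+nC[k+1]≡[n+1]C[k+1] n k))) (ℤ.pos-+ (n C k) (n C suc k))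

-- The exponents `suc (n ∸ suc k)` and `n ∸ k` differ once truncation sets in at `k ≥ n`; exactly
-- there the binomial coefficient vanishes.
C*^-suc : ∀ c n k → + (n C suc k) *ℤ (c *ℤ c ^ℤ (n ∸ suc k)) ≡ + (n C suc k) *ℤ c ^ℤ (n ∸ k)
C*^-suc c n k with suc k ≤? n
... | yes k<n = cong (λ e → + (n C suc k) *ℤ c ^ℤ e) (sym (+-∸-assoc 1 k<n))
... | no k≮n = trans (cong (λ x → + x *ℤ (c *ℤ c ^ℤ (n ∸ suc k))) nC[1+k]≡0)
                     (cong (λ x → + x *ℤ c ^ℤ (n ∸ k)) (sym nC[1+k]≡0))
  where
  nC[1+k]≡0 : n C suc k ≡ 0
  nC[1+k]≡0 = k>n⇒nCk≡0 (≰⇒> k≮n)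

-- h N i plays the role of φ (A ^ i (A + c) ^ N) for a linear functional φ.
binomial-recurrence :
  ∀ c (h : ℕ → ℕ → ℤ) →
  (∀ N i → h (suc N) i ≡ h N (suc i) +ℤ c *ℤ h N i) →
  ∀ N i → h N i ≡ ∑[ k ≤ N ] (+ (N C toℕ k) *ℤ c ^ℤ (N ∸ toℕ k) *ℤ h 0 (toℕ k + i))
binomial-recurrence c h rec zero    i = aux (h 0 i)
  where
  aux : ∀ x → x ≡ 1ℤ *ℤ 1ℤ *ℤ x +ℤ 0ℤ
  aux = ℤ.solve-∀
binomial-recurrence c h rec (suc N) i = begin
  h (suc N) i
    ≡⟨ rec N i ⟩
  h N (suc i) +ℤ c *ℤ h N i
    ≡⟨ cong₂ (λ x y → x +ℤ c *ℤ y) (binomial-recurrence c h rec N (suc i))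
                                 (binomial-recurrence c h rec N i) ⟩
  ∑[ k ≤ N ] u (toℕ k) +ℤ c *ℤ ∑[ k ≤ N ] v (toℕ k)
    -- Splitting off `k = 0` and shifting the index aligns the second sum with the first, so that
    -- Pascal's rule can join them.
    ≡⟨ cong (λ x → ∑[ k ≤ N ] u (toℕ k) +ℤ x) shifted ⟩
  ∑[ k ≤ N ] u (toℕ k) +ℤ (w₀ +ℤ ∑[ k ≤ N ] w (toℕ k))
    ≡⟨ swap (∑[ k ≤ N ] u (toℕ k)) w₀ (∑[ k ≤ N ] w (toℕ k)) ⟩
  w₀ +ℤ (∑[ k ≤ N ] u (toℕ k) +ℤ ∑[ k ≤ N ] w (toℕ k))
    ≡⟨ cong (λ x → w₀ +ℤ x) (∑-distrib-+ {suc N} (u ∘ toℕ) (w ∘ toℕ)) ⟨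
  w₀ +ℤ ∑[ k ≤ N ] (u (toℕ k) +ℤ w (toℕ k))
    ≡⟨ cong (λ x → w₀ +ℤ x) (sum-cong-≗ {suc N} (combine ∘ toℕ)) ⟩
  ∑[ k ≤ suc N ] (+ (suc N C toℕ k) *ℤ c ^ℤ (suc N ∸ toℕ k) *ℤ h 0 (toℕ k + i)) ∎
  where
  open ≡-Reasoning
  u v w : ℕ → ℤ
  u k = + (N C k) *ℤ c ^ℤ (N ∸ k) *ℤ h 0 (k + suc i)
  v k = + (N C k) *ℤ c ^ℤ (N ∸ k) *ℤ h 0 (k + i)
  w k = + (N C suc k) *ℤ c ^ℤ (N ∸ k) *ℤ h 0 (suc k + i)
  w₀ : ℤ
  w₀ = + (suc N C 0) *ℤ c ^ℤ suc N *ℤ h 0 i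

  swap : ∀ x y z → x +ℤ (y +ℤ z) ≡ y +ℤ (x +ℤ z)
  swap = ℤ.solve-∀

  combine : ∀ k → u k +ℤ w k ≡ + (suc N C suc k) *ℤ c ^ℤ (N ∸ k) *ℤ h 0 (suc k + i)
  combine k = trans
    (cong (λ j → + (N C k) *ℤ c ^ℤ (N ∸ k) *ℤ h 0 j +ℤ w k) (+-suc k i))
    (trans (aux (+ (N C k)) (+ (N C suc k)) (c ^ℤ (N ∸ k)) (h 0 (suc k + i)))
           (cong (λ x → x *ℤ c ^ℤ (N ∸ k) *ℤ h 0 (suc k + i)) (sym (pascal N k))))
    where
    aux : ∀ x y z t → x *ℤ z *ℤ t +ℤ y *ℤ z *ℤ t ≡ (x +ℤ y) *ℤ z *ℤ t
    aux = ℤ.solve-∀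

  v-suc : ∀ k → c *ℤ v (suc k) ≡ w k
  v-suc k = trans (aux c (+ (N C suc k)) (c ^ℤ (N ∸ suc k)) (h 0 (suc k + i)))
                  (cong (_*ℤ h 0 (suc k + i)) (C*^-suc c N k))
    where
    aux : ∀ c x z t → c *ℤ (x *ℤ z *ℤ t) ≡ x *ℤ (c *ℤ z) *ℤ t
    aux = ℤ.solve-∀

  -- The shifted sum runs over `k < N` only; this vanishing top term extends it to `k ≤ N`.
  w-N : w N ≡ 0ℤ
  w-N = cong (λ x → + x *ℤ c ^ℤ (N ∸ N) *ℤ h 0 (suc N + i)) (k>n⇒nCk≡0 (n<1+n N))

  shifted : c *ℤ ∑[ k ≤ N ] v (toℕ k) ≡ w₀ +ℤ ∑[ k ≤ N ] w (toℕ k)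
  shifted = begin
    c *ℤ (v 0 +ℤ ∑[ k < N ] v (suc (toℕ k)))
      ≡⟨ ℤ.*-distribˡ-+ c (v 0) (∑[ k < N ] v (suc (toℕ k))) ⟩
    c *ℤ v 0 +ℤ c *ℤ ∑[ k < N ] v (suc (toℕ k))
      ≡⟨ cong₂ _+ℤ_ (aux c (c ^ℤ N) (h 0 i))
           (trans (*-distribˡ-sum {N} c (v ∘ suc ∘ toℕ)) (sum-cong-≗ {N} (v-suc ∘ toℕ))) ⟩
    w₀ +ℤ ∑[ k < N ] w (toℕ k)
      ≡⟨ cong (λ x → w₀ +ℤ x) (trans (sum-last N w)
           (trans (cong (λ x → ∑[ k < N ] w (toℕ k) +ℤ x) w-N) (ℤ.+-identityʳ _))) ⟨
    w₀ +ℤ ∑[ k ≤ N ] w (toℕ k) ∎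
    where
    aux : ∀ c x t → c *ℤ (1ℤ *ℤ x *ℤ t) ≡ 1ℤ *ℤ (c *ℤ x) *ℤ t
    aux = ℤ.solve-∀

-- Series, linear operators on them, and the coefficient expansion of `B`.

-- A sequence f stands for the polynomial (or power series) Σ f m X ^ m.
Series : Set
Series = ℕ → ℤ

one : Series
one zero    = 1ℤ
one (suc _) = 0ℤ

X· : Series → Series
X· f zero    = 0ℤ
X· f (suc m) = f m

[X+_]· : ℤ → Series → Series
[X+ c ]· f m = X· f m +ℤ c *ℤ f m

iter : (Series → Series) → ℕ → Series → Series
iter A zero    f = f
iter A (suc n) f = A (iter A n f)

-- Equality of series is pointwise, so respect for it is a field. The combination `f + c g` in the
-- other field is the shape produced by an operator `A + c`.
record Linear (A : Series → Series) : Set where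
  field
    cong-≗ : ∀ {f g} → f ≗ g → A f ≗ A g
    linear : ∀ f c g → A (λ m → f m +ℤ c *ℤ g m) ≗ (λ m → A f m +ℤ c *ℤ A g m)
open Linear

X·-linear : Linear X·
X·-linear .cong-≗ f≗g zero    = refl
X·-linear .cong-≗ f≗g (suc m) = f≗g m
X·-linear .linear f c g zero    = sym (trans (ℤ.+-identityˡ _) (ℤ.*-zeroʳ c))
X·-linear .linear f c g (suc m) = refl

∘-linear : ∀ {A A′} → Linear A → Linear A′ → Linear (A ∘ A′)
∘-linear lin lin′ .cong-≗ = cong-≗ lin ∘ cong-≗ lin′
∘-linear {A} {A′} lin lin′ .linear f c g m =
  trans (cong-≗ lin (linear lin′ f c g) m) (linear lin (A′ f) c (A′ g) m)

[X+c]·-linear : ∀ c → Linear [X+ c ]·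
[X+c]·-linear c .cong-≗ f≗g m = cong₂ (λ x y → x +ℤ c *ℤ y) (cong-≗ X·-linear f≗g m) (f≗g m)
[X+c]·-linear c .linear f e g m =
  trans (cong (λ x → x +ℤ c *ℤ (f m +ℤ e *ℤ g m)) (linear X·-linear f e g m))
        (aux (X· f m) (X· g m) (f m) (g m) c e)
  where
  aux : ∀ x y u v c e → x +ℤ e *ℤ y +ℤ c *ℤ (u +ℤ e *ℤ v) ≡ x +ℤ c *ℤ u +ℤ e *ℤ (y +ℤ c *ℤ v)
  aux = ℤ.solve-∀

iter-linear : ∀ {A} → Linear A → ∀ n → Linear (iter A n)
iter-linear lin zero    = record { cong-≗ = λ f≗g → f≗g ; linear = λ _ _ _ _ → refl }
iter-linear lin (suc n) = ∘-linear lin (iter-linear lin n)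

iter-suc : ∀ A n f → iter A (suc n) f ≡ iter A n (A f)
iter-suc A zero    f = refl
iter-suc A (suc n) f = cong A (iter-suc A n f)

iter-cong : ∀ {A A′} → Linear A → (∀ f → A f ≗ A′ f) → ∀ n f → iter A n f ≗ iter A′ n f
iter-cong lin eq zero    f m = refl
iter-cong {A} {A′} lin eq (suc n) f m =
  trans (cong-≗ lin (iter-cong lin eq n f) m) (eq (iter A′ n f) m)

commute-iter : ∀ {A A′} → Linear A → Linear A′ → (∀ f → A (A′ f) ≗ A′ (A f)) →
               ∀ n f → A (iter A′ n f) ≗ iter A′ n (A f)
commute-iter lin lin′ comm zero    f m = refl
commute-iter {A} {A′} lin lin′ comm (suc n) f m =
  trans (comm (iter A′ n f) m) (cong-≗ lin′ (commute-iter lin lin′ comm n f) m)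

iter-∘ : ∀ {A A′} → Linear A → Linear A′ → (∀ f → A (A′ f) ≗ A′ (A f)) →
         ∀ n f → iter (A ∘ A′) n f ≗ iter A n (iter A′ n f)
iter-∘ lin lin′ comm zero    f m = refl
iter-∘ {A} {A′} lin lin′ comm (suc n) f m = begin
  A (A′ (iter (A ∘ A′) n f)) m
    ≡⟨ cong-≗ (∘-linear lin lin′) (iter-∘ lin lin′ comm n f) m ⟩
  A (A′ (iter A n (iter A′ n f))) m
    ≡⟨ cong-≗ lin (commute-iter lin′ lin (λ g k → sym (comm g k)) n (iter A′ n f)) m ⟩
  A (iter A n (A′ (iter A′ n f))) m ∎
  where open ≡-Reasoning

-- Taking the coefficient at `m` is the functional to which `binomial-recurrence` is applied; the
-- recurrence for `h` is the linearity of `A ^ i`.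
operator-binomial :
  ∀ {A} → Linear A → ∀ c N f m →
  iter (λ g j → A g j +ℤ c *ℤ g j) N f m ≡
  ∑[ k ≤ N ] (+ (N C toℕ k) *ℤ c ^ℤ (N ∸ toℕ k) *ℤ iter A (toℕ k) f m)
operator-binomial {A} lin c N f m =
  trans (binomial-recurrence c h rec N 0)
        (sum-cong-≗ {suc N} λ k →
          cong (λ i → + (N C toℕ k) *ℤ c ^ℤ (N ∸ toℕ k) *ℤ iter A i f m) (+-identityʳ (toℕ k)))
  where
  A+c : Series → Series
  A+c g j = A g j +ℤ c *ℤ g j
  h : ℕ → ℕ → ℤ
  h N i = iter A i (iter A+c N f) m
  rec : ∀ N i → h (suc N) i ≡ h N (suc i) +ℤ c *ℤ h N i
  rec N i = trans (linear (iter-linear lin i) (A (iter A+c N f)) c (iter A+c N f) m)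
                  (cong (λ g → g m +ℤ c *ℤ h N i) (sym (iter-suc A i (iter A+c N f))))

iter-X· : ∀ k f l → iter X· k f (k + l) ≡ f l
iter-X· zero    f l = refl
iter-X· (suc k) f l = iter-X· k f l

iter-[X+c]·-one : ∀ c n m → iter [X+ c ]· n one m ≡ + (n C m) *ℤ c ^ℤ (n ∸ m)
iter-[X+c]·-one c zero    zero    = refl
iter-[X+c]·-one c zero    (suc m) = refl
iter-[X+c]·-one c (suc n) zero =
  trans (cong (λ x → 0ℤ +ℤ c *ℤ x) (iter-[X+c]·-one c n 0)) (aux c (c ^ℤ n))
  where
  aux : ∀ c x → 0ℤ +ℤ c *ℤ (1ℤ *ℤ x) ≡ 1ℤ *ℤ (c *ℤ x)
  aux = ℤ.solve-∀
iter-[X+c]·-one c (suc n) (suc m) = begin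
  iter [X+ c ]· n one m +ℤ c *ℤ iter [X+ c ]· n one (suc m)
    ≡⟨ cong₂ (λ x y → x +ℤ c *ℤ y) (iter-[X+c]·-one c n m) (iter-[X+c]·-one c n (suc m)) ⟩
  + (n C m) *ℤ c ^ℤ (n ∸ m) +ℤ c *ℤ (+ (n C suc m) *ℤ c ^ℤ (n ∸ suc m))
    ≡⟨ cong (λ x → + (n C m) *ℤ c ^ℤ (n ∸ m) +ℤ x) (trans
         (aux c (+ (n C suc m)) (c ^ℤ (n ∸ suc m))) (C*^-suc c n m)) ⟩
  + (n C m) *ℤ c ^ℤ (n ∸ m) +ℤ + (n C suc m) *ℤ c ^ℤ (n ∸ m)
    ≡⟨ ℤ.*-distribʳ-+ (c ^ℤ (n ∸ m)) (+ (n C m)) (+ (n C suc m)) ⟨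
  (+ (n C m) +ℤ + (n C suc m)) *ℤ c ^ℤ (n ∸ m)
    ≡⟨ cong (_*ℤ c ^ℤ (n ∸ m)) (pascal n m) ⟨
  + (suc n C suc m) *ℤ c ^ℤ (n ∸ m) ∎
  where
  open ≡-Reasoning
  aux : ∀ c x y → c *ℤ (x *ℤ y) ≡ x *ℤ (c *ℤ y)
  aux = ℤ.solve-∀

[X+c]·-comm : ∀ a b f → [X+ a ]· ([X+ b ]· f) ≗ [X+ b ]· ([X+ a ]· f)
[X+c]·-comm a b f zero    = aux a b (f 0)
  where
  aux : ∀ a b x → 0ℤ +ℤ a *ℤ (0ℤ +ℤ b *ℤ x) ≡ 0ℤ +ℤ b *ℤ (0ℤ +ℤ a *ℤ x)
  aux = ℤ.solve-∀
[X+c]·-comm a b f (suc m) = aux a b (X· f m) (f m) (f (suc m))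
  where
  aux : ∀ a b x y z → x +ℤ b *ℤ y +ℤ a *ℤ (y +ℤ b *ℤ z) ≡ x +ℤ a *ℤ y +ℤ b *ℤ (y +ℤ a *ℤ z)
  aux = ℤ.solve-∀

X·-[X+c]·-comm : ∀ c f → X· ([X+ c ]· f) ≗ [X+ c ]· (X· f)
X·-[X+c]·-comm c f zero    = sym (trans (ℤ.+-identityˡ _) (ℤ.*-zeroʳ c))
X·-[X+c]·-comm c f (suc m) = refl

-- The product is arranged as an operator `X (X + (a + b))` plus a scalar `a b`, the form that
-- `operator-binomial` expands.
quadratic : ∀ a b f → [X+ a ]· ([X+ b ]· f) ≗ λ m → X· ([X+ a +ℤ b ]· f) m +ℤ a *ℤ b *ℤ f m
quadratic a b f zero    = aux a b (f 0)
  where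
  aux : ∀ a b x → 0ℤ +ℤ a *ℤ (0ℤ +ℤ b *ℤ x) ≡ 0ℤ +ℤ a *ℤ b *ℤ x
  aux = ℤ.solve-∀
quadratic a b f (suc m) = aux a b (X· f m) (f m) (f (suc m))
  where
  aux : ∀ a b x y z → x +ℤ b *ℤ y +ℤ a *ℤ (y +ℤ b *ℤ z) ≡ x +ℤ (a +ℤ b) *ℤ y +ℤ a *ℤ b *ℤ z
  aux = ℤ.solve-∀

-- Both sides are the coefficient of X ^ N in (X + a) ^ N (X + b) ^ N.
B-expansion : ∀ N a b →
  B N 2 a b ≡ ∑[ k ≤ N ] (+ (N C toℕ k) *ℤ (a *ℤ b) ^ℤ (N ∸ toℕ k) *ℤ
                          (+ (toℕ k C (N ∸ toℕ k)) *ℤ (a +ℤ b) ^ℤ (toℕ k ∸ (N ∸ toℕ k))))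
B-expansion N a b = begin
  B N 2 a b
    -- Only `(X + a) ^ N` is expanded; the coefficient of `(X + b) ^ N` that `X ^ k` moves to degree
    -- `N` supplies the second binomial coefficient.
    ≡⟨ sum-cong-≗ {suc N} left ⟩
  ∑[ k ≤ N ] (+ (N C toℕ k) *ℤ a ^ℤ (N ∸ toℕ k) *ℤ iter X· (toℕ k) (iter [X+ b ]· N one) N)
    ≡⟨ operator-binomial X·-linear a N (iter [X+ b ]· N one) N ⟨
  iter [X+ a ]· N (iter [X+ b ]· N one) N
    ≡⟨ iter-∘ ([X+c]·-linear a) ([X+c]·-linear b) ([X+c]·-comm a b) N one N ⟨
  iter ([X+ a ]· ∘ [X+ b ]·) N one N
    ≡⟨ iter-cong (∘-linear ([X+c]·-linear a) ([X+c]·-linear b)) (quadratic a b) N one N ⟩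
  iter (λ f m → X· ([X+ a +ℤ b ]· f) m +ℤ a *ℤ b *ℤ f m) N one N
    ≡⟨ operator-binomial (∘-linear X·-linear ([X+c]·-linear (a +ℤ b))) (a *ℤ b) N one N ⟩
  ∑[ k ≤ N ] (+ (N C toℕ k) *ℤ (a *ℤ b) ^ℤ (N ∸ toℕ k) *ℤ iter (X· ∘ [X+ a +ℤ b ]·) (toℕ k) one N)
    ≡⟨ sum-cong-≗ {suc N} (λ k → cong (+ (N C toℕ k) *ℤ (a *ℤ b) ^ℤ (N ∸ toℕ k) *ℤ_) (right k)) ⟩
  _ ∎
  where
  open ≡-Reasoning
  iter-X·≤ : ∀ (k : Fin (suc N)) f → iter X· (toℕ k) f N ≡ f (N ∸ toℕ k)
  iter-X·≤ k f = trans (cong (iter X· (toℕ k) f) (sym (m+[n∸m]≡n (Fin.toℕ≤pred[n] k))))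
                       (iter-X· (toℕ k) f (N ∸ toℕ k))
  left : ∀ (k : Fin (suc N)) →
    (+ (N C toℕ k)) ^ℤ 2 *ℤ a ^ℤ (N ∸ toℕ k) *ℤ b ^ℤ toℕ k ≡
    + (N C toℕ k) *ℤ a ^ℤ (N ∸ toℕ k) *ℤ iter X· (toℕ k) (iter [X+ b ]· N one) N
  left k = trans (aux (+ (N C toℕ k)) (a ^ℤ (N ∸ toℕ k)) (b ^ℤ toℕ k))
                 (cong (+ (N C toℕ k) *ℤ a ^ℤ (N ∸ toℕ k) *ℤ_) (sym coefficient))
    where
    coefficient : iter X· (toℕ k) (iter [X+ b ]· N one) N ≡ + (N C toℕ k) *ℤ b ^ℤ toℕ k
    coefficient = begin
      iter X· (toℕ k) (iter [X+ b ]· N one) N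
        ≡⟨ iter-X·≤ k (iter [X+ b ]· N one) ⟩
      iter [X+ b ]· N one (N ∸ toℕ k)
        ≡⟨ iter-[X+c]·-one b N (N ∸ toℕ k) ⟩
      + (N C (N ∸ toℕ k)) *ℤ b ^ℤ (N ∸ (N ∸ toℕ k))
        ≡⟨ cong₂ (λ c e → + c *ℤ b ^ℤ e) (nCk≡nC[n∸k] (Fin.toℕ≤pred[n] k))
                                       (sym (m∸[m∸n]≡n (Fin.toℕ≤pred[n] k))) ⟨
      + (N C toℕ k) *ℤ b ^ℤ toℕ k ∎
    aux : ∀ x y z → x *ℤ (x *ℤ 1ℤ) *ℤ y *ℤ z ≡ x *ℤ y *ℤ (x *ℤ z)
    aux = ℤ.solve-∀
  right : ∀ (k : Fin (suc N)) → iter (X· ∘ [X+ a +ℤ b ]·) (toℕ k) one N ≡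
    + (toℕ k C (N ∸ toℕ k)) *ℤ (a +ℤ b) ^ℤ (toℕ k ∸ (N ∸ toℕ k))
  right k = trans (iter-∘ X·-linear ([X+c]·-linear (a +ℤ b)) (X·-[X+c]·-comm (a +ℤ b)) (toℕ k) one N)
           (trans (iter-X·≤ k (iter [X+ a +ℤ b ]· (toℕ k) one))
                  (iter-[X+c]·-one (a +ℤ b) (toℕ k) (N ∸ toℕ k)))

-- Factorial form of the terms.

choose : ∀ k r → ((k + r) C k) * (k ! * r !) ≡ (k + r) !
choose k r = begin
  ((k + r) C k) * (k ! * r !)
    ≡⟨ cong (λ x → ((k + r) C k) * (k ! * x !)) (m+n∸m≡n k r) ⟨
  ((k + r) C k) * (k ! * (k + r ∸ k) !)
    ≡⟨ cong (_* (k ! * (k + r ∸ k) !)) (nCk≡n!/k![n-k]! (m≤m+n k r)) ⟩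
  _
    ≡⟨ m/n*n≡m (k![n∸k]!∣n! (m≤m+n k r)) ⟩
  (k + r) ! ∎
  where
  open ≡-Reasoning
  instance _ = k !* (k + r ∸ k) !≢0

-- After multiplication by (i ! r !) ^ 2 both sides become (2 (i + r) + d)!.
term-identity :
  ∀ d (M : ℕ → ℕ) → (∀ n → M n * (n ! * n !) ≡ (2 * n + d) !) →
  ∀ i r → ((2 * (i + r) + d) C (i + r + d + i)) * ((i + r + d + i) C r) * M i ≡
          M (i + r) * (((i + r) C i) * ((i + r) C i))
term-identity d M M-! i r = *-cancelʳ-≡ _ _ (r ! * r ! * (i ! * i !)) (begin
  A * E * M i * (r ! * r ! * (i ! * i !))
    ≡⟨ regroup A E (M i) (r !) (i !) ⟩
  A * (E * (r ! * (M i * (i ! * i !))) * r !)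
    ≡⟨ cong (λ x → A * (E * (r ! * x) * r !)) (M-! i) ⟩
  A * (E * (r ! * (2 * i + d) !) * r !)
    ≡⟨ cong (λ x → A * (x * r !)) E-! ⟩
  A * ((i + r + d + i) ! * r !)
    ≡⟨ A-! ⟩
  (2 * (i + r) + d) !
    ≡⟨ M-! (i + r) ⟨
  M (i + r) * ((i + r) ! * (i + r) !)
    ≡⟨ cong (λ x → M (i + r) * (x * x)) (choose i r) ⟨
  M (i + r) * (((i + r) C i) * (i ! * r !) * (((i + r) C i) * (i ! * r !)))
    ≡⟨ regroup′ (M (i + r)) ((i + r) C i) (r !) (i !) ⟩
  M (i + r) * (((i + r) C i) * ((i + r) C i)) * (r ! * r ! * (i ! * i !)) ∎)
  where
  open ≡-Reasoning
  A = (2 * (i + r) + d) C (i + r + d + i)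
  E = (i + r + d + i) C r
  instance
    _ = m*n≢0 (r ! * r !) (i ! * i !) {{r !* r !≢0}} {{i !* i !≢0}}

  regroup : ∀ a e m x y → a * e * m * (x * x * (y * y)) ≡ a * (e * (x * (m * (y * y))) * x)
  regroup = solve-∀
  regroup′ : ∀ m c x y → m * (c * (y * x) * (c * (y * x))) ≡ m * (c * c) * (x * x * (y * y))
  regroup′ = solve-∀
  k-split : ∀ i r d → r + (2 * i + d) ≡ i + r + d + i
  k-split = solve-∀
  N-split : ∀ i r d → i + r + d + i + r ≡ 2 * (i + r) + d
  N-split = solve-∀

  E-! : E * (r ! * (2 * i + d) !) ≡ (i + r + d + i) !
  E-! = trans (cong (λ k → (k C r) * (r ! * (2 * i + d) !)) (sym (k-split i r d)))
              (trans (choose r (2 * i + d)) (cong _! (k-split i r d)))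
  A-! : A * ((i + r + d + i) ! * r !) ≡ (2 * (i + r) + d) !
  A-! = trans (cong (λ N → (N C (i + r + d + i)) * ((i + r + d + i) ! * r !)) (sym (N-split i r d)))
              (trans (choose (i + r + d + i) r) (cong _! (N-split i r d)))

-- Coprimality, and splitting off the part of a number coprime to `s`.

coprime-* : ∀ {m n k} → Coprime m k → Coprime n k → Coprime (m * n) k
coprime-* {m} {n} c c′ {g} (g∣mn , g∣k) = c′ (coprime-divisor g⊥m g∣mn , g∣k)
  where
  g⊥m : Coprime g m
  g⊥m (h∣g , h∣m) = c (h∣m , ∣-trans h∣g g∣k)

coprime-^ : ∀ {m k} → Coprime m k → ∀ n → Coprime (m ^ n) k
coprime-^ c zero    = Coprimality.1-coprimeTo _
coprime-^ c (suc n) = coprime-* c (coprime-^ c n)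

coprime-∣ : ∀ {m n k} → m ∣ n → Coprime n k → Coprime m k
coprime-∣ m∣n c (g∣m , g∣k) = c (∣-trans g∣m m∣n , g∣k)

coprime⇒*∣ : ∀ {m n k} → Coprime m n → m ∣ k → n ∣ k → m * n ∣ k
coprime⇒*∣ {m} {n} c (divides q refl) n∣k =
  subst (_∣ q * m) (*-comm n m)
    (*-monoˡ-∣ m (coprime-divisor (Coprimality.sym c) (subst (n ∣_) (*-comm q m) n∣k)))

^-monoˡ-∣ : ∀ {m n} k → m ∣ n → m ^ k ∣ n ^ k
^-monoˡ-∣ zero    m∣n = ∣-refl
^-monoˡ-∣ (suc k) m∣n = *-pres-∣ m∣n (^-monoˡ-∣ k m∣n)

-- Divide D repeatedly by its gcd with s: each step removes a factor at least c.
coprime-part :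
  ∀ c m D s .{{_ : NonZero D}} → D < c ^ suc m →
  (∀ g → g ∣ D → g ∣ s → g ≢ 1 → c ≤ g) →
  ∃ λ v → Coprime v s × D ∣ v * s ^ m
coprime-part c m D s D<c^[1+m] big with ℕ.gcd D s ≟ 1
coprime-part c m D s D<c^[1+m] big | yes g≡1 =
  D , gcd≡1⇒coprime g≡1 , m∣m*n (s ^ m)
-- Now `D < c`, so a nontrivial gcd, being at least `c`, would exceed the number it divides.
coprime-part c zero D s D<c big | no g≢1 =
  contradiction (≤-trans (big _ (ℕ.gcd[m,n]∣m D s) (ℕ.gcd[m,n]∣n D s) g≢1) (∣⇒≤ (ℕ.gcd[m,n]∣m D s)))
                (<⇒≱ (subst (D <_) (*-identityʳ c) D<c))
coprime-part c (suc m) D s D<c^[2+m] big | no g≢1 with ℕ.gcd[m,n]∣m D s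
... | divides q D≡q*g =
  -- Recursion on `q = D / gcd D s`: dividing by at least `c` lowers the bound to `c ^ suc m`, and
  -- the removed gcd is absorbed by one more factor `s`.
  let v , v⊥s , q∣v*s^m = coprime-part c m q s {{q≢0}} q<c^[1+m] λ h h∣q → big h (∣-trans h∣q q∣D)
  in v , v⊥s , subst₂ _∣_ (sym D≡q*g) (regroup v s (s ^ m)) (*-pres-∣ q∣v*s^m (ℕ.gcd[m,n]∣n D s))
  where
  open ≤-Reasoning
  q∣D : q ∣ D
  q∣D = divides (ℕ.gcd D s) (trans D≡q*g (*-comm q (ℕ.gcd D s)))
  q≢0 : NonZero q
  q≢0 = ≢-nonZero λ q≡0 → ≢-nonZero⁻¹ D (trans D≡q*g (cong (_* ℕ.gcd D s) q≡0))
  q<c^[1+m] : q < c ^ suc m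
  q<c^[1+m] = *-cancelˡ-< c q (c ^ suc m) (begin-strict
    c * q         ≡⟨ *-comm c q ⟩
    q * c         ≤⟨ *-monoʳ-≤ q (big _ (ℕ.gcd[m,n]∣m D s) (ℕ.gcd[m,n]∣n D s) g≢1) ⟩
    q * ℕ.gcd D s   ≡⟨ D≡q*g ⟨
    D             <⟨ D<c^[2+m] ⟩
    c * c ^ suc m ∎)
  regroup : ∀ v s x → v * x * s ≡ v * (s * x)
  regroup = solve-∀

divisor≥2 : ∀ {D g} .{{_ : NonZero D}} → g ∣ D → g ≢ 1 → 2 ≤ g
divisor≥2 {D} {zero}        0∣D _   = contradiction (0∣⇒≡0 0∣D) (≢-nonZero⁻¹ D)
divisor≥2 {g = suc zero}    _   g≢1 = contradiction refl g≢1
divisor≥2 {g = suc (suc _)} _   _   = s≤s (s≤s z≤n)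

divisor≥3 : ∀ {D g} .{{_ : NonZero D}} → g ∣ D → ¬ 2 ∣ g → g ≢ 1 → 3 ≤ g
divisor≥3 g∣D 2∤g g≢1 = ≤∧≢⇒< (divisor≥2 g∣D g≢1) λ { refl → 2∤g ∣-refl }

-- Recurrences and size bounds for central binomial coefficients, and their coprime parts.

-- By `rec` and `r<`, consecutive ratios lie below `c`; the bound telescopes from `f 0 ≡ 1`.
ratio-bound :
  ∀ c (f r : ℕ → ℕ) → f 0 ≡ 1 → (∀ n → NonZero (f n)) →
  (∀ n → suc n * f (suc n) ≡ r n * f n) → (∀ n → r n < c * suc n) →
  ∀ n → f (suc n) < c ^ suc n
ratio-bound c f r f₀≡1 f≢0 rec r< = bound
  where
  open ≤-Reasoning
  step : ∀ n → f (suc n) < c * f n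
  step n = *-cancelˡ-< (suc n) (f (suc n)) (c * f n) (begin-strict
    suc n * f (suc n) ≡⟨ rec n ⟩
    r n * f n         <⟨ *-monoˡ-< (f n) {{f≢0 n}} (r< n) ⟩
    c * suc n * f n   ≡⟨ regroup c (suc n) (f n) ⟩
    suc n * (c * f n) ∎)
    where
    regroup : ∀ c n x → c * n * x ≡ n * (c * x)
    regroup = solve-∀
  bound : ∀ n → f (suc n) < c ^ suc n
  bound zero    = subst (λ x → f 1 < c * x) f₀≡1 (step 0)
  bound (suc n) = <-≤-trans (step (suc n)) (*-monoʳ-≤ c (<⇒≤ (bound n)))

-- `central` and `odd-central` are `M n = (2 n + d)! / (n !) ^ 2` for `d = 0` and `d = 1`.
central : ℕ → ℕ
central n = (2 * n) C n

odd-central : ℕ → ℕ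
odd-central n = (2 * n + 1) * ((2 * n) C n)

2*n≡n+n : ∀ n → 2 * n ≡ n + n
2*n≡n+n = solve-∀

central-! : ∀ n → central n * (n ! * n !) ≡ (2 * n) !
central-! n = trans (cong (λ N → (N C n) * (n ! * n !)) (2*n≡n+n n))
                    (trans (choose n n) (cong _! (sym (2*n≡n+n n))))

central-!₀ : ∀ n → central n * (n ! * n !) ≡ (2 * n + 0) !
central-!₀ n = trans (central-! n) (cong _! (sym (+-identityʳ (2 * n))))

odd-central-! : ∀ n → odd-central n * (n ! * n !) ≡ (2 * n + 1) !
odd-central-! n = begin
  (2 * n + 1) * central n * (n ! * n !)   ≡⟨ *-assoc (2 * n + 1) (central n) _ ⟩
  (2 * n + 1) * (central n * (n ! * n !)) ≡⟨ cong ((2 * n + 1) *_) (central-! n) ⟩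
  (2 * n + 1) * (2 * n) !                 ≡⟨ cong (_* (2 * n) !) (+-comm (2 * n) 1) ⟩
  suc (2 * n) !                           ≡⟨ cong _! (+-comm (2 * n) 1) ⟨
  (2 * n + 1) ! ∎
  where open ≡-Reasoning

central≢0 : ∀ n → NonZero (central n)
central≢0 n = ≢-nonZero λ c≡0 →
  ≢-nonZero⁻¹ ((2 * n) !) {{(2 * n) !≢0}} (trans (sym (central-! n)) (cong (_* (n ! * n !)) c≡0))

odd-central≢0 : ∀ n → NonZero (odd-central n)
odd-central≢0 n = m*n≢0 (2 * n + 1) (central n) {{>-nonZero (m≤n+m 1 (2 * n))}} {{central≢0 n}}

-- Both sides become `(2 n + 2)!` after multiplication by `(n + 1) (n !) ^ 2`.
central-suc : ∀ n → suc n * central (suc n) ≡ (2 * (2 * n + 1)) * central n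
central-suc n = *-cancelʳ-≡ _ _ (suc n * (n ! * n !)) (begin
  suc n * central (suc n) * (suc n * (n ! * n !))
    ≡⟨ regroup (suc n) (central (suc n)) (n !) ⟩
  central (suc n) * (suc n ! * suc n !)
    ≡⟨ central-! (suc n) ⟩
  (2 * suc n) !
    ≡⟨ cong _! (*-suc 2 n) ⟩
  suc (suc (2 * n)) * (suc (2 * n) * (2 * n) !)
    ≡⟨ cong (λ x → suc (suc (2 * n)) * (suc (2 * n) * x)) (central-! n) ⟨
  suc (suc (2 * n)) * (suc (2 * n) * (central n * (n ! * n !)))
    ≡⟨ regroup′ n (central n) (n !) ⟩
  2 * (2 * n + 1) * central n * (suc n * (n ! * n !)) ∎)
  where
  open ≡-Reasoning
  instance
    _ = m*n≢0 (suc n) (n ! * n !) {{_}} {{n !* n !≢0}}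
  regroup : ∀ k c x → k * c * (k * (x * x)) ≡ c * (k * x * (k * x))
  regroup = solve-∀
  regroup′ : ∀ n c x → suc (suc (2 * n)) * (suc (2 * n) * (c * (x * x))) ≡
                       2 * (2 * n + 1) * c * (suc n * (x * x))
  regroup′ = solve-∀

odd-central-suc : ∀ n → suc n * odd-central (suc n) ≡ (2 * (2 * n + 3)) * odd-central n
odd-central-suc n = begin
  suc n * ((2 * suc n + 1) * central (suc n))
    ≡⟨ regroup n (central (suc n)) ⟩
  (2 * n + 3) * (suc n * central (suc n))
    ≡⟨ cong ((2 * n + 3) *_) (central-suc n) ⟩
  (2 * n + 3) * (2 * (2 * n + 1) * central n)
    ≡⟨ regroup′ n (central n) ⟩
  2 * (2 * n + 3) * ((2 * n + 1) * central n) ∎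
  where
  open ≡-Reasoning
  regroup : ∀ n c → suc n * ((2 * suc n + 1) * c) ≡ (2 * n + 3) * (suc n * c)
  regroup = solve-∀
  regroup′ : ∀ n c → (2 * n + 3) * (2 * (2 * n + 1) * c) ≡ 2 * (2 * n + 3) * ((2 * n + 1) * c)
  regroup′ = solve-∀

square-^-suc : ∀ c j → (c ^ 2) ^ suc j ≡ c ^ suc (suc (2 * j))
square-^-suc c j = trans (^-*-assoc c 2 (suc j)) (cong (c ^_) (*-suc 2 j))

-- The ratios `2 (2 n + 1) / (n + 1)` are below `4 = 2 ^ 2`. The exponent is `2 i` for `i = suc j`,
-- spelt as the `suc m` of `coprime-part` with `m = 2 i - 1`.
central< : ∀ j → central (suc j) < 2 ^ suc (suc (2 * j))
central< j = subst (central (suc j) <_) (square-^-suc 2 j)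
  (ratio-bound 4 central (λ n → 2 * (2 * n + 1)) refl central≢0 central-suc
    (λ n → subst (2 * (2 * n + 1) <_) (regroup n) (m<m+n _ (s≤s z≤n))) j)
  where
  regroup : ∀ n → 2 * (2 * n + 1) + 2 ≡ 4 * suc n
  regroup = solve-∀

-- The ratio `2 (2 n + 3) / (n + 1)` is 6 at `n = 0`, which rules out 4; the next square, 9, gives
-- base 3 with the same exponent `2 i`.
odd-central< : ∀ j → odd-central (suc j) < 3 ^ suc (suc (2 * j))
odd-central< j = subst (odd-central (suc j) <_) (square-^-suc 3 j)
  (ratio-bound 9 odd-central (λ n → 2 * (2 * n + 3)) refl odd-central≢0 odd-central-suc
    (λ n → subst (2 * (2 * n + 3) <_) (regroup n) (m<m+n _ (s≤s z≤n))) j)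
  where
  regroup : ∀ n → 2 * (2 * n + 3) + (3 + 5 * n) ≡ 9 * suc n
  regroup = solve-∀

-- The exponent of `s` is `2 i - 1`, one less than in the `i`-th term of the expansion; the spare
-- factor `s` is what makes that term negligible.
central-coprime-part : ∀ s j → ∃ λ v → Coprime v s × central (suc j) ∣ v * s ^ suc (2 * j)
central-coprime-part s j =
  coprime-part 2 (suc (2 * j)) (central (suc j)) s {{central≢0 (suc j)}} (central< j)
    λ g g∣D _ → divisor≥2 {{central≢0 (suc j)}} g∣D

odd⇒coprime-2 : ∀ {m} → ¬ 2 ∣ m → Coprime m 2
odd⇒coprime-2 2∤m {g} (g∣m , g∣2) with g ≟ 1
... | yes g≡1 = g≡1
... | no  g≢1 = contradiction
  (subst (_∣ _) (≤-antisym (∣⇒≤ g∣2) (divisor≥2 g∣2 g≢1)) g∣m) 2∤m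

-- D = (2 i + 1) C(2 i, i) is too large for coprime-part with c = 2, so the prime 2 is treated
-- apart: its powers in D are those in C(2 i, i) < 2 ^ (2 i), and D < 3 ^ (2 i) bounds the odd part.
odd-central-coprime-part :
  ∀ s j → ∃ λ v → Coprime v s × odd-central (suc j) ∣ v * s ^ suc (2 * j)
odd-central-coprime-part s j with 2 ∣? s
... | no 2∤s =
  -- Divisors of `s` are odd here, so nontrivial ones are at least 3.
  coprime-part 3 m D s (odd-central< j)
    λ g g∣D g∣s → divisor≥3 g∣D λ 2∣g → 2∤s (∣-trans 2∣g g∣s)
  where
  m = suc (2 * j)
  D = odd-central (suc j)
  instance _ = odd-central≢0 (suc j)
... | yes 2∣s =
  -- Taking 2 in place of `s` isolates the powers of 2 in `C(2 i, i)`; `O` is odd because `u` and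
  -- `2 i + 1` are.
  let u , u⊥2 , c∣u*2^m = central-coprime-part 2 j
      O = (2 * suc j + 1) * u
      -- No bound on `O` is known. The gcd with `D` is at most `D`, stays odd, and `D` still divides
      -- `y * 2 ^ m`.
      y = ℕ.gcd D O
      D∣O*2^m : D ∣ O * 2 ^ m
      D∣O*2^m = subst (D ∣_) (sym (*-assoc (2 * suc j + 1) u (2 ^ m)))
                             (*-monoʳ-∣ (2 * suc j + 1) c∣u*2^m)
      D∣y*2^m : D ∣ y * 2 ^ m
      D∣y*2^m = subst (D ∣_)
        (trans (sym (ℕ.c*gcd[m,n]≡gcd[cm,cn] (2 ^ m) D O)) (*-comm (2 ^ m) y))
        (ℕ.gcd-greatest (n∣m*n (2 ^ m)) (subst (D ∣_) (*-comm O (2 ^ m)) D∣O*2^m))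
      y⊥2 : Coprime y 2
      y⊥2 = coprime-∣ (ℕ.gcd[m,n]∣n D O) (coprime-* (odd⇒coprime-2 (2∤2n+1 (suc j))) u⊥2)
      y≤D = ∣⇒≤ (ℕ.gcd[m,n]∣m D O)
      y≢0 = ≢-nonZero λ y≡0 → ≢-nonZero⁻¹ D (0∣⇒≡0 (subst (_∣ D) y≡0 (ℕ.gcd[m,n]∣m D O)))
      v , v⊥s , y∣v*s^m = coprime-part 3 m y s {{y≢0}} (≤-<-trans y≤D (odd-central< j))
        λ g g∣y _ → divisor≥3 {{y≢0}} g∣y λ 2∣g → contradiction (y⊥2 (∣-trans 2∣g g∣y , ∣-refl)) λ ()
  in v , v⊥s , ∣-trans D∣y*2^m
       -- The coprime numbers `y` and `2 ^ m` both divide `v * s ^ m`, the latter because `s` is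
       -- even.
       (coprime⇒*∣ (Coprimality.sym (coprime-^ (Coprimality.sym y⊥2) m))
                   y∣v*s^m (∣n⇒∣m*n v (^-monoˡ-∣ m 2∣s)))
  where
  m = suc (2 * j)
  D = odd-central (suc j)
  instance _ = odd-central≢0 (suc j)
  2∤2n+1 : ∀ n → ¬ 2 ∣ 2 * n + 1
  2∤2n+1 n 2∣ = contradiction (∣⇒≤ (∣m+n∣m⇒∣n 2∣ (m∣m*n n))) λ { (s≤s ()) }

-- Integers coprime to `s` as denominators.

coprimeℤ-* : ∀ x y {s} → Coprimeℤ x s → Coprimeℤ y s → Coprimeℤ (x *ℤ y) s
coprimeℤ-* x y {s} c c′ = subst (λ m → Coprime m ∣ s ∣) (sym (ℤ.abs-* x y)) (coprime-* c c′)

coprimeℤ-^ : ∀ x {s} → Coprimeℤ x s → ∀ n → Coprimeℤ (x ^ℤ n) s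
coprimeℤ-^ x {s} c n = subst (λ m → Coprime m ∣ s ∣) (sym (abs-^ x n)) (coprime-^ c n)

coprimeℤ-+* : ∀ x y {s} → Coprimeℤ x s → Coprimeℤ (x +ℤ s *ℤ y) s
coprimeℤ-+* x y {s} c {g} (g∣x+sy , g∣s) = c (∣⇒∣ᵤ {+ g} {x} g∣x , g∣s)
  where
  g∣x : + g ∣ℤ x
  g∣x = ℤ.∣m+n∣n⇒∣m {m = x} (∣ᵤ⇒∣ g∣x+sy) (ℤ.∣m⇒∣m*n y (∣ᵤ⇒∣ {+ g} {s} g∣s))

coprime-sum : ∀ a b → gcd a b ≡ 1ℤ → Coprimeℤ a (a +ℤ b)
coprime-sum a b gcd≡1 {g} (g∣a , g∣a+b) =
  gcd≡1⇒coprime (ℤ.+-injective gcd≡1) (g∣a , ∣⇒∣ᵤ {+ g} {b} g∣b)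
  where
  g∣b : + g ∣ℤ b
  g∣b = ℤ.∣m+n∣m⇒∣n {m = a} (∣ᵤ⇒∣ {+ g} {a +ℤ b} g∣a+b) (∣ᵤ⇒∣ {+ g} {a} g∣a)

-- The coprimality of `a` and `b` enters here: it makes `p ^ n` in the main term coprime to `s`.
coprime-product-sum : ∀ a b → gcd a b ≡ 1ℤ → Coprimeℤ (a *ℤ b) (a +ℤ b)
coprime-product-sum a b gcd≡1 =
  coprimeℤ-* a b {a +ℤ b} (coprime-sum a b gcd≡1)
    (subst (Coprimeℤ b) (ℤ.+-comm b a) (coprime-sum b a (trans (ℤ.gcd-comm b a) gcd≡1)))

-- X lies in the ideal (K s) after localisation at the integers coprime to s.
record Negligible (s K X : ℤ) : Set where
  constructor negligible
  field
    v w      : ℤ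
    v⊥s      : Coprimeℤ v s
    equation : v *ℤ X ≡ K *ℤ (s *ℤ w)

negligible-0 : ∀ s K → Negligible s K 0ℤ
negligible-0 s K = negligible 1ℤ 0ℤ (Coprimality.1-coprimeTo ∣ s ∣) (aux s K)
  where
  aux : ∀ s K → 1ℤ *ℤ 0ℤ ≡ K *ℤ (s *ℤ 0ℤ)
  aux = ℤ.solve-∀

-- Addition of fractions with denominators `v` and `v′`, whose product stays coprime to `s`.
negligible-+ : ∀ {s K X Y} → Negligible s K X → Negligible s K Y → Negligible s K (X +ℤ Y)
negligible-+ {s} {K} {X} {Y} (negligible v w v⊥s vX≡) (negligible v′ w′ v′⊥s v′Y≡) =
  negligible (v *ℤ v′) (v′ *ℤ w +ℤ v *ℤ w′) (coprimeℤ-* v v′ {s} v⊥s v′⊥s) (begin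
    v *ℤ v′ *ℤ (X +ℤ Y)
      ≡⟨ expand v v′ X Y ⟩
    v′ *ℤ (v *ℤ X) +ℤ v *ℤ (v′ *ℤ Y)
      ≡⟨ cong₂ (λ x y → v′ *ℤ x +ℤ v *ℤ y) vX≡ v′Y≡ ⟩
    v′ *ℤ (K *ℤ (s *ℤ w)) +ℤ v *ℤ (K *ℤ (s *ℤ w′))
      ≡⟨ collect v v′ s K w w′ ⟩
    K *ℤ (s *ℤ (v′ *ℤ w +ℤ v *ℤ w′)) ∎)
  where
  open ≡-Reasoning
  expand : ∀ v v′ X Y → v *ℤ v′ *ℤ (X +ℤ Y) ≡
           v′ *ℤ (v *ℤ X) +ℤ v *ℤ (v′ *ℤ Y)
  expand = ℤ.solve-∀
  collect : ∀ v v′ s K w w′ → v′ *ℤ (K *ℤ (s *ℤ w)) +ℤ v *ℤ (K *ℤ (s *ℤ w′)) ≡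
            K *ℤ (s *ℤ (v′ *ℤ w +ℤ v *ℤ w′))
  collect = ℤ.solve-∀

negligible-sum : ∀ {s K n} (f : Fin n → ℤ) → (∀ k → Negligible s K (f k)) → Negligible s K (sum f)
negligible-sum {s} {K} {zero}  f negl = negligible-0 s K
negligible-sum {s} {K} {suc n} f negl =
  negligible-+ (negl Fin.zero) (negligible-sum (f ∘ Fin.suc) (negl ∘ Fin.suc))

-- The terms of the expansion and the factorisation of `B`, for both parities at once.

-- The `k`-th summand of `B-expansion`, with `p = a b` and `s = a + b`. Where the last exponent is
-- truncated, `k < N ∸ k` and the second binomial coefficient is zero.
term : ℕ → ℤ → ℤ → ℕ → ℤ
term N p s k = + (N C k) *ℤ p ^ℤ (N ∸ k) *ℤ (+ (k C (N ∸ k)) *ℤ s ^ℤ (k ∸ (N ∸ k)))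

module _ (d : ℕ) (d≤1 : d ≤ 1) (M : ℕ → ℕ)
         (M-! : ∀ n → M n * (n ! * n !) ≡ (2 * n + d) !)
         (M-0 : M 0 ≡ 1)
         (M≢0 : ∀ n → NonZero (M n))
         (M-coprime-part : ∀ s j → ∃ λ v → Coprime v s × M (suc j) ∣ v * s ^ suc (2 * j))
         where

  -- Multiplying by `M i` avoids a division. With `n = i + r` and `k = n + d + i`, the exponents are
  -- `N ∸ k = r` and `k ∸ r = 2 i + d`.
  term-value : ∀ p s i r →
    term (2 * (i + r) + d) p s (i + r + d + i) *ℤ + M i ≡
    s ^ℤ d *ℤ + M (i + r) *ℤ (+ (((i + r) C i) * ((i + r) C i)) *ℤ p ^ℤ r *ℤ s ^ℤ (2 * i))
  term-value p s i r = begin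
    term N p s k *ℤ + M i
      ≡⟨ cong (λ l → + (N C k) *ℤ p ^ℤ l *ℤ (+ (k C l) *ℤ s ^ℤ (k ∸ l)) *ℤ + M i) N∸k≡r ⟩
    + (N C k) *ℤ p ^ℤ r *ℤ (+ (k C r) *ℤ s ^ℤ (k ∸ r)) *ℤ + M i
      ≡⟨ cong (λ l → + (N C k) *ℤ p ^ℤ r *ℤ (+ (k C r) *ℤ l) *ℤ + M i) s^[k∸r] ⟩
    + (N C k) *ℤ p ^ℤ r *ℤ (+ (k C r) *ℤ (s ^ℤ (2 * i) *ℤ s ^ℤ d)) *ℤ + M i
      ≡⟨ regroup (+ (N C k)) (p ^ℤ r) (+ (k C r)) (s ^ℤ (2 * i)) (s ^ℤ d) (+ M i) ⟩
    s ^ℤ d *ℤ (+ (N C k) *ℤ + (k C r) *ℤ + M i) *ℤ p ^ℤ r *ℤ s ^ℤ (2 * i)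
      ≡⟨ cong (λ x → s ^ℤ d *ℤ x *ℤ p ^ℤ r *ℤ s ^ℤ (2 * i)) identity ⟩
    s ^ℤ d *ℤ (+ M (i + r) *ℤ + c²) *ℤ p ^ℤ r *ℤ s ^ℤ (2 * i)
      ≡⟨ regroup′ (s ^ℤ d) (+ M (i + r)) (+ c²) (p ^ℤ r) (s ^ℤ (2 * i)) ⟩
    s ^ℤ d *ℤ + M (i + r) *ℤ (+ c² *ℤ p ^ℤ r *ℤ s ^ℤ (2 * i)) ∎
    where
    open ≡-Reasoning
    N = 2 * (i + r) + d
    k = i + r + d + i
    c² = ((i + r) C i) * ((i + r) C i)
    N-split : ∀ i r d → 2 * (i + r) + d ≡ i + r + d + i + r
    N-split = solve-∀
    k-split : ∀ i r d → i + r + d + i ≡ r + (2 * i + d)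
    k-split = solve-∀
    N∸k≡r : N ∸ k ≡ r
    N∸k≡r = trans (cong (_∸ k) (N-split i r d)) (m+n∸m≡n k r)
    s^[k∸r] : s ^ℤ (k ∸ r) ≡ s ^ℤ (2 * i) *ℤ s ^ℤ d
    s^[k∸r] = trans (cong (s ^ℤ_) (trans (cong (_∸ r) (k-split i r d)) (m+n∸m≡n r _)))
                    (ℤ.^-distribˡ-+-* s (2 * i) d)
    identity : + (N C k) *ℤ + (k C r) *ℤ + M i ≡ + M (i + r) *ℤ + c²
    identity = begin
      + (N C k) *ℤ + (k C r) *ℤ + M i       ≡⟨ cong (_*ℤ + M i) (ℤ.pos-* (N C k) (k C r)) ⟨
      + ((N C k) * (k C r)) *ℤ + M i     ≡⟨ ℤ.pos-* ((N C k) * (k C r)) (M i) ⟨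
      + ((N C k) * (k C r) * M i)     ≡⟨ cong +_ (term-identity d M M-! i r) ⟩
      + (M (i + r) * c²)                ≡⟨ ℤ.pos-* (M (i + r)) c² ⟩
      + M (i + r) *ℤ + c²                  ∎
    regroup : ∀ A x E y z m → A *ℤ x *ℤ (E *ℤ (y *ℤ z)) *ℤ m ≡ z *ℤ (A *ℤ E *ℤ m) *ℤ x *ℤ y
    regroup = ℤ.solve-∀
    regroup′ : ∀ z m c x y → z *ℤ (m *ℤ c) *ℤ x *ℤ y ≡ z *ℤ m *ℤ (c *ℤ x *ℤ y)
    regroup′ = ℤ.solve-∀

  term-main : ∀ p s n → term (2 * n + d) p s (n + d) ≡ s ^ℤ d *ℤ + M n *ℤ p ^ℤ n
  term-main p s n = begin
    term (2 * n + d) p s (n + d)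
      ≡⟨ cong (term (2 * n + d) p s) (+-identityʳ (n + d)) ⟨
    term (2 * n + d) p s (n + d + 0)
      ≡⟨ ℤ.*-identityʳ _ ⟨
    term (2 * n + d) p s (n + d + 0) *ℤ 1ℤ
      ≡⟨ cong (λ m → term (2 * n + d) p s (n + d + 0) *ℤ + m) M-0 ⟨
    term (2 * n + d) p s (n + d + 0) *ℤ + M 0
      ≡⟨ term-value p s 0 n ⟩
    s ^ℤ d *ℤ + M n *ℤ (1ℤ *ℤ p ^ℤ n *ℤ 1ℤ)
      ≡⟨ cong (s ^ℤ d *ℤ + M n *ℤ_) (trans (ℤ.*-identityʳ _) (ℤ.*-identityˡ _)) ⟩
    s ^ℤ d *ℤ + M n *ℤ p ^ℤ n ∎
    where open ≡-Reasoning

  -- Of the `2 i` factors `s` beyond `s ^ d`, one is kept as the required multiple of `s`; the other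
  -- `2 i - 1`, times `v`, are divisible by `M i`, which is then cancelled.
  term-negligible : ∀ p s j r →
    Negligible s (s ^ℤ d *ℤ + M (suc j + r)) (term (2 * (suc j + r) + d) p s (suc j + r + d + suc j))
  term-negligible p s j r = negligible (+ v) (+ c² *ℤ p ^ℤ r *ℤ c) v⊥s (ℤ.*-cancelʳ-≡ _ _ (+ M i) (begin
    + v *ℤ T *ℤ + M i
      ≡⟨ ℤ.*-assoc (+ v) T (+ M i) ⟩
    + v *ℤ (T *ℤ + M i)
      ≡⟨ cong (+ v *ℤ_) (term-value p s i r) ⟩
    + v *ℤ (K *ℤ (+ c² *ℤ p ^ℤ r *ℤ s ^ℤ (2 * i)))
      ≡⟨ cong (λ e → + v *ℤ (K *ℤ (+ c² *ℤ p ^ℤ r *ℤ s ^ℤ e))) (*-suc 2 j) ⟩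
    + v *ℤ (K *ℤ (+ c² *ℤ p ^ℤ r *ℤ (s *ℤ s ^ℤ m)))
      ≡⟨ regroup (+ v) K (+ c²) (p ^ℤ r) s (s ^ℤ m) ⟩
    K *ℤ (s *ℤ (+ c² *ℤ p ^ℤ r *ℤ (+ v *ℤ s ^ℤ m)))
      ≡⟨ cong (λ x → K *ℤ (s *ℤ (+ c² *ℤ p ^ℤ r *ℤ x))) v*s^m≡c*M ⟩
    K *ℤ (s *ℤ (+ c² *ℤ p ^ℤ r *ℤ (c *ℤ + M i)))
      ≡⟨ regroup′ K s (+ c² *ℤ p ^ℤ r) c (+ M i) ⟩
    K *ℤ (s *ℤ (+ c² *ℤ p ^ℤ r *ℤ c)) *ℤ + M i ∎))
    where
    open ≡-Reasoning
    i = suc j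
    m = suc (2 * j)
    c² = ((i + r) C i) * ((i + r) C i)
    K = s ^ℤ d *ℤ + M (i + r)
    T = term (2 * (i + r) + d) p s (i + r + d + i)
    instance
      _ = M≢0 i
    part = M-coprime-part ∣ s ∣ j
    v = proj₁ part
    v⊥s = proj₁ (proj₂ part)
    M∣v*s^m : + M i ∣ℤ + v *ℤ s ^ℤ m
    M∣v*s^m = ∣ᵤ⇒∣ (subst (M i ∣_)
      (sym (trans (ℤ.abs-* (+ v) (s ^ℤ m)) (cong (v *_) (abs-^ s m)))) (proj₂ (proj₂ part)))
    c = ℤ.quotient M∣v*s^m
    v*s^m≡c*M = ℤ._∣_.equality M∣v*s^m
    regroup : ∀ v K c x s y → v *ℤ (K *ℤ (c *ℤ x *ℤ (s *ℤ y))) ≡ K *ℤ (s *ℤ (c *ℤ x *ℤ (v *ℤ y)))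
    regroup = ℤ.solve-∀
    regroup′ : ∀ K s x c M → K *ℤ (s *ℤ (x *ℤ (c *ℤ M))) ≡ K *ℤ (s *ℤ (x *ℤ c)) *ℤ M
    regroup′ = ℤ.solve-∀

  -- Below the main index `n + d` the terms vanish; above it they are `term-negligible` with
  -- `k = n + d + suc j`.
  other-term-negligible : ∀ p s n k → k ≤ 2 * n + d → k ≢ n + d →
    Negligible s (s ^ℤ d *ℤ + M n) (term (2 * n + d) p s k)
  other-term-negligible p s n k k≤N k≢n+d with <-cmp k (n + d)
  ... | tri≈ _ k≡n+d _ = contradiction k≡n+d k≢n+d
  ... | tri< k<n+d _ _ = subst (Negligible s _) (sym vanishes) (negligible-0 s _)
    where
    open ≤-Reasoning
    N = 2 * n + d
    -- From `k < n + d` follows `2 k + 2 ≤ 2 n + 2 d = N + d ≤ N + 1`, the last step by `d ≤ 1`.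
    -- Hence `k < N ∸ k`.
    2k<N : suc k + k ≤ N
    2k<N = ≤-pred (begin
      suc (suc k + k)     ≡⟨ cong suc (+-suc k k) ⟨
      suc k + suc k       ≤⟨ +-mono-≤ k<n+d k<n+d ⟩
      n + d + (n + d)     ≡⟨ regroup n d ⟩
      d + N               ≤⟨ +-monoˡ-≤ N d≤1 ⟩
      suc N               ∎)
      where
      regroup : ∀ n d → n + d + (n + d) ≡ d + (2 * n + d)
      regroup = solve-∀
    vanishes : term N p s k ≡ 0ℤ
    vanishes = trans
      (cong (λ x → + (N C k) *ℤ p ^ℤ (N ∸ k) *ℤ (+ x *ℤ s ^ℤ (k ∸ (N ∸ k))))
            (k>n⇒nCk≡0 (m+n≤o⇒m≤o∸n (suc k) 2k<N)))
      (ℤ.*-zeroʳ (+ (N C k) *ℤ p ^ℤ (N ∸ k)))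
  ... | tri> _ _ n+d<k with m≤n⇒∃[o]m+o≡n n+d<k | m≤n⇒∃[o]m+o≡n k≤N
  ... | j , refl | r , k+r≡N = at-split
    (+-cancelˡ-≡ (n + d) n (suc j + r) (trans (left n d) (trans (sym k+r≡N) (right n d j r))))
    where
    left : ∀ n d → n + d + n ≡ 2 * n + d
    left = solve-∀
    right : ∀ n d j r → suc (n + d) + j + r ≡ n + d + (suc j + r)
    right = solve-∀
    at-split : ∀ {n} → n ≡ suc j + r →
      Negligible s (s ^ℤ d *ℤ + M n) (term (2 * n + d) p s (suc (n + d) + j))
    at-split refl = subst
        (λ k → Negligible s (s ^ℤ d *ℤ + M (suc j + r)) (term (2 * (suc j + r) + d) p s k))
        (+-suc (suc j + r + d) j) (term-negligible p s j r)

  -- The main term is `K p ^ n` with `K = s ^ d (M n)`, and all others together lie in the localised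
  -- ideal `(K s)`. The factors `V` and `E`, coprime to `s`, do not affect `ω`.
  B-factorisation : ∀ n a b → gcd a b ≡ 1ℤ → ∃₂ λ V E →
    Coprimeℤ V (a +ℤ b) × Coprimeℤ E (a +ℤ b) ×
    V *ℤ B (2 * n + d) 2 a b ≡ (a +ℤ b) ^ℤ d *ℤ + M n *ℤ E
  B-factorisation n a b gcd≡1 =
    let R = sum (removeAt t k₀)
        negligible V w V⊥s V*R≡ = negligible-sum (removeAt t k₀) λ k →
          other-term-negligible p s n (toℕ (punchIn k₀ k)) (Fin.toℕ≤pred[n] (punchIn k₀ k))
            λ eq → Fin.punchInᵢ≢i k₀ k (Fin.toℕ-injective (trans eq (sym toℕ-k₀)))
        p⊥s = coprime-product-sum a b gcd≡1
    -- `E` is congruent to `V p ^ n` modulo `s`, hence coprime to `s`.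
    in V , V *ℤ p ^ℤ n +ℤ s *ℤ w , V⊥s
     , coprimeℤ-+* (V *ℤ p ^ℤ n) w {s} (coprimeℤ-* V (p ^ℤ n) {s} V⊥s (coprimeℤ-^ p {s} p⊥s n))
     , (begin
      V *ℤ B N 2 a b
        ≡⟨ cong (V *ℤ_) (B-expansion N a b) ⟩
      V *ℤ sum t
        ≡⟨ cong (V *ℤ_) (sum-remove {i = k₀} t) ⟩
      V *ℤ (t k₀ +ℤ R)
        ≡⟨ cong (λ x → V *ℤ (x +ℤ R))
             (trans (cong (term N p s) toℕ-k₀) (term-main p s n)) ⟩
      V *ℤ (K *ℤ p ^ℤ n +ℤ R)
        ≡⟨ ℤ.*-distribˡ-+ V (K *ℤ p ^ℤ n) R ⟩
      V *ℤ (K *ℤ p ^ℤ n) +ℤ V *ℤ R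
        ≡⟨ cong (λ x → V *ℤ (K *ℤ p ^ℤ n) +ℤ x) V*R≡ ⟩
      V *ℤ (K *ℤ p ^ℤ n) +ℤ K *ℤ (s *ℤ w)
        ≡⟨ regroup V K (p ^ℤ n) (s *ℤ w) ⟩
      K *ℤ (V *ℤ p ^ℤ n +ℤ s *ℤ w) ∎)
    where
    open ≡-Reasoning
    N = 2 * n + d
    s = a +ℤ b
    p = a *ℤ b
    K = s ^ℤ d *ℤ + M n
    t : Fin (suc N) → ℤ
    t k = term N p s (toℕ k)
    n+d<1+N : n + d < suc N
    n+d<1+N = s≤s (+-monoˡ-≤ d (m≤m+n n (n + 0)))
    k₀ = fromℕ< n+d<1+N
    toℕ-k₀ : toℕ k₀ ≡ n + d
    toℕ-k₀ = Fin.toℕ-fromℕ< n+d<1+N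
    regroup : ∀ V K x y → V *ℤ (K *ℤ x) +ℤ K *ℤ y ≡ K *ℤ (V *ℤ x +ℤ y)
    regroup = ℤ.solve-∀

-- Behaviour of `ω` under multiplication, and the conclusion.

module _ (x : ℤ) (x≢0 : x ≢ 0ℤ) (x≢1 : x ≢ 1ℤ) (x≢-1 : x ≢ -1ℤ) where

  ω-mono : ∀ y z → z ≢ 0ℤ → (∀ e → x ^ℤ e ∣ℤ y → x ^ℤ e ∣ℤ z) → ω x y ≤ ω x z
  ω-mono y z z≢0 imp = ω-largest x z x≢0 x≢1 x≢-1 z≢0 (ω x y) (imp (ω x y) (ω-∣ x y))

  -- For composite `x`, `ω x` is not additive, but a factor `x` itself can be cancelled from
  -- `x ^ suc e ∣ x * y`.
  ω-* : ∀ y → y ≢ 0ℤ → ω x (x *ℤ y) ≡ 1 + ω x y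
  ω-* y y≢0 = ≤-antisym (bound (ω x (x *ℤ y)) (ω-∣ x (x *ℤ y)))
    (ω-largest x (x *ℤ y) x≢0 x≢1 x≢-1 xy≢0 (suc (ω x y)) (ℤ.*-monoʳ-∣ x (ω-∣ x y)))
    where
    xy≢0 : x *ℤ y ≢ 0ℤ
    xy≢0 xy≡0 with ℤ.i*j≡0⇒i≡0∨j≡0 x xy≡0
    ... | inj₁ x≡0 = x≢0 x≡0
    ... | inj₂ y≡0 = y≢0 y≡0
    bound : ∀ e → x ^ℤ e ∣ℤ x *ℤ y → e ≤ 1 + ω x y
    bound zero    _     = z≤n
    bound (suc e) x^∣xy =
      s≤s (ω-largest x y x≢0 x≢1 x≢-1 y≢0 e (ℤ.*-cancelˡ-∣ x {{ℤ.≢-nonZero x≢0}} x^∣xy))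

  -- Each `x ^ e` is coprime to `u` and `v`, so Euclid's lemma carries divisibility by it across the
  -- equation in both directions.
  ω-coprime-multiple : ∀ y z u v → z ≢ 0ℤ → Coprimeℤ u x → Coprimeℤ v x → u *ℤ y ≡ z *ℤ v →
                       y ≢ 0ℤ × ω x y ≡ ω x z
  ω-coprime-multiple y z u v z≢0 u⊥x v⊥x uy≡zv =
    y≢0 , ≤-antisym (ω-mono y z z≢0 λ e → ∣-transfer y z v u e v⊥x (trans (ℤ.*-comm v z) (sym uy≡zv)))
                    (ω-mono z y y≢0 λ e → ∣-transfer z y u v e u⊥x (trans uy≡zv (ℤ.*-comm z v)))
    where
    v≢0 : v ≢ 0ℤ
    -- Zero is coprime only to units, whereas `∣ x ∣ > 1`.
    v≢0 refl = <⇒≢ (1<∣ x ∣ x≢0 x≢1 x≢-1) (sym (Coprimality.0-coprimeTo-m⇒m≡1 v⊥x))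
    y≢0 : y ≢ 0ℤ
    y≢0 refl with ℤ.i*j≡0⇒i≡0∨j≡0 z (trans (sym uy≡zv) (ℤ.*-zeroʳ u))
    ... | inj₁ z≡0 = z≢0 z≡0
    ... | inj₂ v≡0 = v≢0 v≡0
    ∣-transfer : ∀ y z v u e → Coprimeℤ v x → v *ℤ z ≡ u *ℤ y → x ^ℤ e ∣ℤ y → x ^ℤ e ∣ℤ z
    ∣-transfer y z v u e v⊥x vz≡uy x^e∣y = ∣ᵤ⇒∣ (ℤ.coprime-divisor (x ^ℤ e) v z
      (coprimeℤ-^ x {v} (ℤ.sym {v} {x} v⊥x) e)
      (∣⇒∣ᵤ (subst (x ^ℤ e ∣ℤ_) (sym vz≡uy) (ℤ.∣n⇒∣m*n u x^e∣y))))

theorem1 : (n : ℕ) (a b : ℤ) → gcd a b ≡ 1ℤ →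
    a +ℤ b ≢ 0ℤ → a +ℤ b ≢ 1ℤ → a +ℤ b ≢ -1ℤ →
    (B (2 * n) 2 a b ≢ 0ℤ ×
     ω (a +ℤ b) (B (2 * n) 2 a b) ≡ ω (a +ℤ b) (+ ((2 * n) C n)))
    ×
    (B (2 * n + 1) 2 a b ≢ 0ℤ ×
     ω (a +ℤ b) (B (2 * n + 1) 2 a b) ≡ 1 + ω (a +ℤ b) (+ ((2 * n + 1) * ((2 * n) C n))))
theorem1 n a b gcd≡1 s≢0 s≢1 s≢-1 = even , odd
  where
  s = a +ℤ b
  +≢0 : ∀ {m} → NonZero m → + m ≢ 0ℤ
  +≢0 m≢0 +m≡0 = ≢-nonZero⁻¹ _ {{m≢0}} (ℤ.+-injective +m≡0)

  even : B (2 * n) 2 a b ≢ 0ℤ × ω s (B (2 * n) 2 a b) ≡ ω s (+ central n)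
  even =
    let V , E , V⊥s , E⊥s , VB≡ =
          B-factorisation 0 z≤n central central-!₀ refl central≢0 central-coprime-part n a b gcd≡1
    in ω-coprime-multiple s s≢0 s≢1 s≢-1 (B (2 * n) 2 a b) (+ central n) V E
         (+≢0 (central≢0 n)) V⊥s E⊥s
         (trans (cong (λ N → V *ℤ B N 2 a b) (sym (+-identityʳ (2 * n))))
                (trans VB≡ (cong (_*ℤ E) (ℤ.*-identityˡ (+ central n)))))

  odd : B (2 * n + 1) 2 a b ≢ 0ℤ × ω s (B (2 * n + 1) 2 a b) ≡ 1 + ω s (+ odd-central n)
  odd =
    let V , E , V⊥s , E⊥s , VB≡ =
          B-factorisation 1 ≤-refl odd-central odd-central-! refl odd-central≢0 odd-central-coprime-part n a b gcd≡1
        -- For `d = 1` the common factor is `s (M n)`; its factor `s` becomes the summand 1 through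
        -- `ω-*`.
        B≢0 , ωB≡ = ω-coprime-multiple s s≢0 s≢1 s≢-1 (B (2 * n + 1) 2 a b) (s *ℤ + odd-central n)
          V E sm≢0 V⊥s E⊥s (trans VB≡ (cong (λ x → x *ℤ + odd-central n *ℤ E) (ℤ.*-identityʳ s)))
    in B≢0 , trans ωB≡ (ω-* s s≢0 s≢1 s≢-1 (+ odd-central n) (+≢0 (odd-central≢0 n)))
    where
    sm≢0 : s *ℤ + odd-central n ≢ 0ℤ
    sm≢0 sm≡0 with ℤ.i*j≡0⇒i≡0∨j≡0 s sm≡0
    ... | inj₁ s≡0 = s≢0 s≡0
    ... | inj₂ m≡0 = +≢0 (odd-central≢0 n) m≡0
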